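{- For all positive integers $n$ and $k$, the number of permutations in $s^{ -1}(\mathrm{Av}_n(132,312))$ that have exactly $k-1$ descents is $\mathrm{BoNa}(n,k)$.
   Context: A binary plane tree is a rooted plane tree on unlabeled vertices in which every non-leaf vertex has one or two children, and every child is a left child or a right child, even if it is the only child of its parent. A 0-1-tree is a binary plane tree in which every vertex that has two children is labeled 0 or 1 (no other vertex is labeled). A right edge is an edge connecting a vertex to its right child. For $n\ge 1$, the Boolean-Narayana number $\mathrm{BoNa}(n,k)$ is the number of 0-1-trees on $n$ vertices that have exactly $k-1$ right edges. The stack sorting operation $s$ is defined recursively on finite strings of distinct positive integers (permutations and their substrings): $s$ of the empty string is empty, $s$ of a one-element string is itself, and if $p=LmR$ where $m$ is the maximum entry of $p$, $L$ is the (possibly empty) substring of entries to the left of $m$ and $R$ the (possibly empty) substring of entries to the right of $m$, then $s(p)=s(L)\,s(R)\,m$. A permutation $p=p_1p_2\cdots p_n$ contains the pattern $q=q_1\cdots q_k$ if there are indices $i_1<\cdots<i_k$ such that $p_{i_a}<p_{i_b}$ if and only if $q_a<q_b$; otherwise $p$ avoids $q$. $\mathrm{Av}_n(q,q')$ is the set of permutations of length $n$ that avoid both $q$ and $q'$, and $s^{ -1}(\mathrm{Av}_n(q,q'))$ is the set of permutations $p$ of length $n$ such that $s(p)\in \mathrm{Av}_n(q,q')$. An index $i$ with $1\le i\le n-1$ is a descent of $p$ if $p_i>p_{i+1}$. -}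

module Defs where

open import Level using (0ℓ)
open import Data.Bool.Base using (T; true; false; if_then_else_)
open import Data.Nat.Base
open import Data.Nat.Properties
open import Data.Fin.Base as Fin using (Fin)
open import Data.List.Base
open import Data.List.Properties using (length-++)
open import Data.List.Membership.Propositional using (_∈_)
open import Data.List.Membership.Propositional.Properties
open import Data.List.Relation.Unary.Any using (here; there)
open import Data.List.Relation.Unary.All as All using (All; []; _∷_)
open import Data.List.Relation.Unary.AllPairs using ([]; _∷_)
open import Data.List.Relation.Unary.Unique.Propositional using (Unique)
import Data.List.Relation.Unary.Unique.Propositional.Properties as Unique
open import Data.List.Relation.Binary.Permutation.Propositional using (_↭_)
open import Data.Product.Base using (_×_; _,_; proj₁; proj₂; ∃-syntax)
open import Data.Sum.Base using (inj₁; inj₂)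
open import Function.Bundles using (_⇔_; mk⇔)
open import Relation.Nullary using (¬_; contradiction)
open import Relation.Nullary.Decidable using (_×-dec_)
open import Relation.Unary using (Pred; Decidable)
open import Relation.Binary.PropositionalEquality hiding ([_])

-- Elements are counted, not proofs of membership: the witness is a
-- duplicate-free list of exactly the elements satisfying P.
HasCardinality : {A : Set} → Pred A 0ℓ → ℕ → Set
HasCardinality P N =
  ∃[ xs ] (Unique xs × (∀ x → x ∈ xs ⇔ P x) × length xs ≡ N)

------------------------------------------------------------------------
-- 0-1-trees

data ZeroOneTree : Set where
  leaf      : ZeroOneTree
  onlyLeft  : ZeroOneTree → ZeroOneTree
  onlyRight : ZeroOneTree → ZeroOneTree
  both      : (label : Fin 2) (l r : ZeroOneTree) → ZeroOneTree

vertices : ZeroOneTree → ℕ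
vertices leaf          = 1
vertices (onlyLeft l)  = 1 + vertices l
vertices (onlyRight r) = 1 + vertices r
vertices (both _ l r)  = 1 + (vertices l + vertices r)

rightEdges : ZeroOneTree → ℕ
rightEdges leaf          = 0
rightEdges (onlyLeft l)  = rightEdges l
rightEdges (onlyRight r) = 1 + rightEdges r
rightEdges (both _ l r)  = 1 + (rightEdges l + rightEdges r)

-- "k - 1 right edges" is written without truncated subtraction, so that
-- no tree qualifies for k = 0.
BoNaTree : ℕ → ℕ → Pred ZeroOneTree 0ℓ
BoNaTree n k t = vertices t ≡ n × suc (rightEdges t) ≡ k

BoNaTree? : ∀ n k → Decidable (BoNaTree n k)
BoNaTree? n k t = (vertices t ≟ n) ×-dec (suc (rightEdges t) ≟ k)

both′ : Fin 2 → ZeroOneTree × ZeroOneTree → ZeroOneTree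
both′ i (l , r) = both i l r

-- All trees having at most d levels of vertices; since a tree on n
-- vertices has at most n levels, treesUpTo n contains all of those.
treesUpTo : ℕ → List ZeroOneTree
treesUpTo zero    = []
treesUpTo (suc d) =
  leaf ∷ map onlyLeft ts ++ map onlyRight ts
       ++ cartesianProductWith both′ (allFin 2) (cartesianProduct ts ts)
  where ts = treesUpTo d

BoNa : ℕ → ℕ → ℕ
BoNa n k = length (filter (BoNaTree? n k) (treesUpTo n))

∈-treesUpTo : ∀ d t → vertices t ≤ d → t ∈ treesUpTo d
∈-treesUpTo (suc d) leaf _ = here refl
∈-treesUpTo (suc d) (onlyLeft l) (s≤s h) =
  there (∈-++⁺ˡ (∈-map⁺ onlyLeft (∈-treesUpTo d l h)))
∈-treesUpTo (suc d) (onlyRight r) (s≤s h) =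
  there (∈-++⁺ʳ (map onlyLeft (treesUpTo d))
    (∈-++⁺ˡ (∈-map⁺ onlyRight (∈-treesUpTo d r h))))
∈-treesUpTo (suc d) (both i l r) (s≤s h) =
  there (∈-++⁺ʳ (map onlyLeft (treesUpTo d))
    (∈-++⁺ʳ (map onlyRight (treesUpTo d))
      (∈-cartesianProductWith⁺ both′ (∈-allFin i)
        (∈-cartesianProduct⁺
          (∈-treesUpTo d l (≤-trans (m≤m+n _ _) h))
          (∈-treesUpTo d r (≤-trans (m≤n+m _ _) h))))))

treesUpTo-unique : ∀ d → Unique (treesUpTo d)
treesUpTo-unique zero    = []
treesUpTo-unique (suc d) =
  All.tabulate leaf∉ ∷
  Unique.++⁺ (Unique.map⁺ (λ { refl → refl }) uts)
    (Unique.++⁺ (Unique.map⁺ (λ { refl → refl }) uts)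
      (Unique.cartesianProductWith⁺ both′ (λ { refl → refl , refl })
        (Unique.allFin⁺ 2) (Unique.cartesianProduct⁺ uts uts))
      right≠both)
    left≠rest
  where
  ts  = treesUpTo d
  uts = treesUpTo-unique d
  ls  = map onlyLeft ts
  rs  = map onlyRight ts
  bs  = cartesianProductWith both′ (allFin 2) (cartesianProduct ts ts)

  bs⁻ : ∀ {t} → t ∈ bs → ∃[ i ] ∃[ lr ] t ≡ both′ i lr
  bs⁻ t∈ with _ , _ , _ , _ , eq ←
    ∈-cartesianProductWith⁻ both′ (allFin 2) (cartesianProduct ts ts) t∈ = _ , _ , eq

  leaf∉ : ∀ {t} → t ∈ ls ++ rs ++ bs → leaf ≢ t
  leaf∉ t∈ refl with ∈-++⁻ ls t∈
  ... | inj₁ t∈ls with () ← proj₂ (proj₂ (∈-map⁻ onlyLeft t∈ls))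
  ... | inj₂ t∈′ with ∈-++⁻ rs t∈′
  ...   | inj₁ t∈rs with () ← proj₂ (proj₂ (∈-map⁻ onlyRight t∈rs))
  ...   | inj₂ t∈bs with () ← proj₂ (proj₂ (bs⁻ t∈bs))

  right≠both : ∀ {t} → ¬ (t ∈ rs × t ∈ bs)
  right≠both (t∈rs , t∈bs)
    with _ , _ , refl ← ∈-map⁻ onlyRight t∈rs
    with () ← proj₂ (proj₂ (bs⁻ t∈bs))

  left≠rest : ∀ {t} → ¬ (t ∈ ls × t ∈ rs ++ bs)
  left≠rest (t∈ls , t∈′) with _ , _ , refl ← ∈-map⁻ onlyLeft t∈ls
    with ∈-++⁻ rs t∈′
  ... | inj₁ t∈rs with () ← proj₂ (proj₂ (∈-map⁻ onlyRight t∈rs))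
  ... | inj₂ t∈bs with () ← proj₂ (proj₂ (bs⁻ t∈bs))

BoNa-counts : ∀ n k → HasCardinality (BoNaTree n k) (BoNa n k)
BoNa-counts n k =
  filter (BoNaTree? n k) (treesUpTo n) ,
  Unique.filter⁺ (BoNaTree? n k) (treesUpTo-unique n) ,
  (λ t → mk⇔
    (λ t∈ → proj₂ (∈-filter⁻ (BoNaTree? n k) {xs = treesUpTo n} t∈))
    (λ h → ∈-filter⁺ (BoNaTree? n k)
             (∈-treesUpTo n t (≤-reflexive (proj₁ h))) h)) ,
  refl

------------------------------------------------------------------------
-- Stack sorting

-- Writes x ∷ xs as L ++ m ∷ R with m its maximum, returning (L , m , R).
splitAtMax : ℕ → List ℕ → List ℕ × ℕ × List ℕ
splitAtMax x []       = [] , x , []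
splitAtMax x (y ∷ ys) =
  let (L , m , R) = splitAtMax y ys in
  if m <ᵇ x then ([] , x , y ∷ ys) else (x ∷ L , m , R)

-- The first argument bounds the recursion depth; any bound not less than
-- the length of the string gives the same result (see sBounded-irrelevant).
sBounded : ℕ → List ℕ → List ℕ
sBounded _       []       = []
sBounded zero    (_ ∷ _)  = []
sBounded (suc b) (x ∷ xs) =
  let (L , m , R) = splitAtMax x xs in
  sBounded b L ++ sBounded b R ++ [ m ]

s : List ℕ → List ℕ
s p = sBounded (length p) p

splitAtMax-length : ∀ x xs → let (L , m , R) = splitAtMax x xs in
                    length L + length R ≡ length xs
splitAtMax-length x []       = refl
splitAtMax-length x (y ∷ ys) with splitAtMax y ys | splitAtMax-length y ys
... | L , m , R | eq with m <ᵇ x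
...   | true  = refl
...   | false = cong suc eq

sBounded-irrelevant : ∀ b c p → length p ≤ b → length p ≤ c →
                      sBounded b p ≡ sBounded c p
sBounded-irrelevant b c [] _ _ = refl
sBounded-irrelevant (suc b) (suc c) (x ∷ xs) (s≤s h) (s≤s h′)
  with splitAtMax x xs | splitAtMax-length x xs
... | L , m , R | eq = cong₂ (λ u v → u ++ v ++ [ m ])
  (sBounded-irrelevant b c L (≤-trans L≤ h) (≤-trans L≤ h′))
  (sBounded-irrelevant b c R (≤-trans R≤ h) (≤-trans R≤ h′))
  where
  L≤ : length L ≤ length xs
  L≤ = subst (length L ≤_) eq (m≤m+n _ _)
  R≤ : length R ≤ length xs
  R≤ = subst (length R ≤_) eq (m≤n+m _ _)

splitAtMax-bound : ∀ {m} x xs → All (_< m) (x ∷ xs) →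
                   proj₁ (proj₂ (splitAtMax x xs)) < m
splitAtMax-bound x []       (x<m ∷ _) = x<m
splitAtMax-bound x (y ∷ ys) (x<m ∷ h)
  with splitAtMax y ys | splitAtMax-bound y ys h
... | L , m′ , R | m′<m with m′ <ᵇ x
...   | true  = x<m
...   | false = m′<m

splitAtMax-head : ∀ m R → All (_< m) R → splitAtMax m R ≡ ([] , m , R)
splitAtMax-head m []       _ = refl
splitAtMax-head m (y ∷ ys) h
  with splitAtMax y ys | splitAtMax-bound y ys h
... | L , m′ , R | m′<m with m′ <ᵇ m in eq
...   | true  = refl
...   | false = contradiction (subst T eq (<⇒<ᵇ m′<m)) (λ ())

splitAtMax-later : ∀ x L m R → All (_< m) (x ∷ L) → All (_< m) R →
                   splitAtMax x (L ++ m ∷ R) ≡ (x ∷ L , m , R)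
splitAtMax-later x [] m R (x<m ∷ _) hR
  rewrite splitAtMax-head m R hR with m <ᵇ x in eq
... | false = refl
... | true  = contradiction
  (<ᵇ⇒< m x (subst T (sym eq) _)) (<⇒≯ x<m)
splitAtMax-later x (y ∷ L) m R (x<m ∷ hL) hR
  rewrite splitAtMax-later y L m R hL hR with m <ᵇ x in eq
... | false = refl
... | true  = contradiction
  (<ᵇ⇒< m x (subst T (sym eq) _)) (<⇒≯ x<m)

-- The defining recursion of s; together with s [] = [] (definitional) it
-- determines s on strings of distinct integers.
s-LmR : ∀ L m R → All (_< m) L → All (_< m) R →
        s (L ++ m ∷ R) ≡ s L ++ s R ++ [ m ]
s-LmR [] m R _ hR rewrite splitAtMax-head m R hR = refl
s-LmR (x ∷ L) m R hL hR rewrite splitAtMax-later x L m R hL hR =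
  cong₂ (λ u v → u ++ v ++ [ m ])
    (sBounded-irrelevant _ _ (x ∷ L) xL≤ ≤-refl)
    (sBounded-irrelevant _ _ R R≤ ≤-refl)
  where
  len : length (L ++ m ∷ R) ≡ length L + suc (length R)
  len = length-++ L
  xL≤ : suc (length L) ≤ length (L ++ m ∷ R)
  xL≤ = subst (suc (length L) ≤_) (sym (trans len (+-suc _ _)))
          (s≤s (m≤m+n _ _))
  R≤ : length R ≤ length (L ++ m ∷ R)
  R≤ = subst (length R ≤_) (sym len) (≤-trans (n≤1+n _) (m≤n+m _ _))

------------------------------------------------------------------------
-- Permutations, patterns, descents

IsPermutation : ℕ → Pred (List ℕ) 0ℓ
IsPermutation n p = p ↭ applyUpTo suc n

Contains : List ℕ → List ℕ → Set
Contains p q = ∃[ ι ] (StrictlyIncreasing ι × OrderIsomorphic ι)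
  where
  StrictlyIncreasing OrderIsomorphic : (Fin (length q) → Fin (length p)) → Set
  StrictlyIncreasing ι = ∀ {a b} → a Fin.< b → ι a Fin.< ι b
  OrderIsomorphic    ι =
    ∀ a b → (lookup p (ι a) < lookup p (ι b)) ⇔ (lookup q a < lookup q b)

Avoids : List ℕ → List ℕ → Set
Avoids p q = ¬ Contains p q

Av : ℕ → List ℕ → List ℕ → Pred (List ℕ) 0ℓ
Av n q q′ p = IsPermutation n p × Avoids p q × Avoids p q′

s⁻¹Av : ℕ → List ℕ → List ℕ → Pred (List ℕ) 0ℓ
s⁻¹Av n q q′ p = IsPermutation n p × Av n q q′ (s p)

descents : List ℕ → ℕ
descents []          = 0
descents (_ ∷ [])    = 0
descents (x ∷ y ∷ p) = (if y <ᵇ x then 1 else 0) + descents (y ∷ p)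

{-# OPTIONS --safe #-}

-- A word avoids 132 and 312 iff each entry is larger or smaller than all
-- entries before it.  Let p = L n R with n maximal, so that s(p) = s(L) s(R) n,
-- and suppose L and R are nonempty.  If r is the first entry of s(R), then s(p)
-- has this property iff s(L) and s(R) have it and no value of R other than r
-- separates the set L ∪ {r}.  Hence, once L and R are given up to order
-- isomorphism, the values of L form the block immediately below or immediately
-- above r: this choice is the label 0 or 1 of the root of the tree of p, whose
-- subtrees are those of L and R.  A descent at n occurs iff R is nonempty,
-- that is, iff the root has a right edge.
module Submission where

open import Defs
open import Data.Bool.Base using (T; true; false; if_then_else_)
open import Data.Fin.Base as Fin using (Fin; zero; suc)
open import Data.Fin.Properties as Fin using (toℕ-injective; toℕ≤pred[n])
open import Data.List.Base hiding (_∷ʳ_; find)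
open import Data.List.Extrema.Nat
  using (min; max; argmin-all; argmax-all; min≤⊤; min≤xs; ⊥≤max; xs≤max)
open import Data.List.Properties
open import Data.List.Membership.Propositional using (_∈_; find)
open import Data.List.Membership.Propositional.Properties
open import Data.List.Membership.Propositional.Properties.WithK using (unique∧set⇒bag)
open import Data.List.Relation.Binary.BagAndSetEquality using (∼bag⇒↭)
open import Data.List.Relation.Binary.Permutation.Propositional
  using (_↭_; ↭-refl; ↭-sym; ↭⇒↭ₛ; module PermutationReasoning)
open import Data.List.Relation.Binary.Permutation.Propositional.Properties as Perm
  using (All-resp-↭; ∈-resp-↭; ↭-length)
open import Data.List.Relation.Binary.Disjoint.Propositional using (Disjoint)
import Data.List.Relation.Binary.Permutation.Setoid.Properties as SetoidPerm
open import Data.List.Relation.Binary.Sublist.Propositional as Sublist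
  using (_⊆_; []; _∷_; _∷ʳ_; minimum)
import Data.List.Relation.Binary.Sublist.Propositional.Properties as Sublist
open import Data.List.Relation.Unary.All as All using (All; []; _∷_)
import Data.List.Relation.Unary.All.Properties as All
open import Data.List.Relation.Unary.AllPairs using ([]; _∷_)
open import Data.List.Relation.Unary.Any using (here; there)
open import Data.List.Relation.Unary.Unique.Propositional using (Unique)
import Data.List.Relation.Unary.Unique.Propositional.Properties as Unique
open import Data.Nat.Base
open import Data.Nat.Properties
open import Data.Product.Base using (_×_; _,_; proj₁; proj₂; ∃-syntax; map₂; uncurry)
open import Data.Sum.Base using (_⊎_; inj₁; inj₂; [_,_]′)
open import Data.Unit.Base using (⊤; tt)
open import Function.Base using (_∘_; id)
open import Function.Bundles using (mk⇔; Equivalence)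
open import Relation.Binary.Definitions using (tri<; tri≈; tri>)
open import Relation.Binary.PropositionalEquality hiding ([_])
open import Relation.Nullary using (¬_; yes; no; contradiction)
open import Relation.Nullary.Decidable using (_→-dec_; toWitness)
open import Relation.Unary using (Pred)
open import Level using (0ℓ)

-- Stack sorting

splitAtMax-++ : ∀ x xs → let (L , m , R) = splitAtMax x xs in x ∷ xs ≡ L ++ m ∷ R
splitAtMax-++ x []       = refl
splitAtMax-++ x (y ∷ ys) with splitAtMax y ys | splitAtMax-++ y ys
... | L , m , R | eq with m <ᵇ x
...   | true  = refl
...   | false = cong (x ∷_) eq

sBounded-↭ : ∀ b p → length p ≤ b → sBounded b p ↭ p
sBounded-↭ b       []       _       = ↭-refl
sBounded-↭ (suc b) (x ∷ xs) (s≤s h)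
  with splitAtMax x xs | splitAtMax-length x xs | splitAtMax-++ x xs
... | L , m , R | len | eq = begin
  sBounded b L ++ sBounded b R ++ [ m ] ↭⟨ Perm.++⁺ (sBounded-↭ b L (≤-trans L≤ h))
                                             (Perm.++⁺ʳ [ m ] (sBounded-↭ b R (≤-trans R≤ h))) ⟩
  L ++ R ++ [ m ]                       ↭⟨ Perm.++⁺ˡ L (Perm.++-comm R [ m ]) ⟩
  L ++ m ∷ R                            ≡⟨ eq ⟨
  x ∷ xs                                ∎
  where
  open PermutationReasoning
  L≤ : length L ≤ length xs
  L≤ = subst (length L ≤_) len (m≤m+n _ _)
  R≤ : length R ≤ length xs
  R≤ = subst (length R ≤_) len (m≤n+m _ _)

s-↭ : ∀ p → s p ↭ p
s-↭ p = sBounded-↭ (length p) p ≤-refl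

-- Invariance under strictly increasing maps

StrictMono : (ℕ → ℕ) → Set
StrictMono f = ∀ {x y} → x < y → f x < f y

module _ {f : ℕ → ℕ} (mono : StrictMono f) where

  strictMono-cancel-< : ∀ {x y} → f x < f y → x < y
  strictMono-cancel-< {x} {y} fx<fy with <-cmp x y
  ... | tri< x<y _ _  = x<y
  ... | tri≈ _ refl _ = contradiction fx<fy (<-irrefl refl)
  ... | tri> _ _ y<x  = contradiction fx<fy (<⇒≯ (mono y<x))

  strictMono-injective : ∀ {x y} → f x ≡ f y → x ≡ y
  strictMono-injective {x} {y} eq with <-cmp x y
  ... | tri< x<y _ _ = contradiction eq (<⇒≢ (mono x<y))
  ... | tri≈ _ x≡y _ = x≡y
  ... | tri> _ _ y<x = contradiction eq (>⇒≢ (mono y<x))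

  <ᵇ-strictMono : ∀ x y → (f x <ᵇ f y) ≡ (x <ᵇ y)
  <ᵇ-strictMono x y with x <ᵇ y in eq | f x <ᵇ f y in eq′
  ... | true  | true  = refl
  ... | false | false = refl
  ... | true  | false = contradiction (subst T eq′ (<⇒<ᵇ (mono (<ᵇ⇒< x y (subst T (sym eq) tt))))) λ ()
  ... | false | true  = contradiction
    (subst T eq (<⇒<ᵇ (strictMono-cancel-< (<ᵇ⇒< (f x) (f y) (subst T (sym eq′) tt))))) λ ()

  splitAtMax-map : ∀ x xs → let (L , m , R) = splitAtMax x xs in
                   splitAtMax (f x) (map f xs) ≡ (map f L , f m , map f R)
  splitAtMax-map x []       = refl
  splitAtMax-map x (y ∷ ys) rewrite splitAtMax-map y ys
    | <ᵇ-strictMono (proj₁ (proj₂ (splitAtMax y ys))) x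
    with proj₁ (proj₂ (splitAtMax y ys)) <ᵇ x
  ... | true  = refl
  ... | false = refl

  sBounded-map : ∀ b p → sBounded b (map f p) ≡ map f (sBounded b p)
  sBounded-map b       []       = refl
  sBounded-map zero    (x ∷ xs) = refl
  sBounded-map (suc b) (x ∷ xs) rewrite splitAtMax-map x xs with splitAtMax x xs
  ... | L , m , R = begin
    sBounded b (map f L) ++ sBounded b (map f R) ++ [ f m ]
      ≡⟨ cong₂ (λ u v → u ++ v ++ [ f m ]) (sBounded-map b L) (sBounded-map b R) ⟩
    map f (sBounded b L) ++ map f (sBounded b R) ++ [ f m ]
      ≡⟨ cong (map f (sBounded b L) ++_) (map-++ f (sBounded b R) [ m ]) ⟨
    map f (sBounded b L) ++ map f (sBounded b R ++ [ m ])
      ≡⟨ map-++ f (sBounded b L) _ ⟨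
    map f (sBounded b L ++ sBounded b R ++ [ m ])             ∎
    where open ≡-Reasoning

  -- Stack sorting uses its entries only through comparisons, which `f` preserves. So `s` can be
  -- computed on the standardized parts of a word and relabelled afterwards.
  s-map : ∀ p → s (map f p) ≡ map f (s p)
  s-map p rewrite length-map f p = sBounded-map (length p) p

  descents-map : ∀ p → descents (map f p) ≡ descents p
  descents-map []          = refl
  descents-map (x ∷ [])    = refl
  descents-map (x ∷ y ∷ p) =
    cong₂ (λ lt d → (if lt then 1 else 0) + d) (<ᵇ-strictMono y x) (descents-map (y ∷ p))

unique-++⁻ : ∀ {A : Set} (u : List A) {v} → Unique (u ++ v) → Unique u × Unique v × Disjoint u v
unique-++⁻ []      h = [] , h , λ ()
unique-++⁻ (x ∷ u) (x∉ ∷ h) with hu , hv , disjoint ← unique-++⁻ u h =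
  All.++⁻ˡ u x∉ ∷ hu , hv ,
  λ { (here refl , z∈v) → All.lookup (All.++⁻ʳ u x∉) z∈v refl
    ; (there z∈u , z∈v) → disjoint (z∈u , z∈v) }

-- Words avoiding 132 and 312

Outside : ℕ → List ℕ → Set
Outside c xs = All (_< c) xs ⊎ All (c <_) xs

-- w continues the word acc so that each entry of w is Outside the entries before it.
OuterFrom : List ℕ → List ℕ → Set
OuterFrom acc []      = ⊤
OuterFrom acc (c ∷ w) = Outside c acc × OuterFrom (acc ++ [ c ]) w

outer-++⁺ : ∀ {acc} u {v} → OuterFrom acc u → OuterFrom (acc ++ u) v → OuterFrom acc (u ++ v)
outer-++⁺ {acc} [] _ h = subst (λ l → OuterFrom l _) (++-identityʳ acc) h
outer-++⁺ {acc} (c ∷ u) (o , hu) hv =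
  o , outer-++⁺ u hu (subst (λ l → OuterFrom l _) (sym (++-assoc acc [ c ] u)) hv)

outer-++⁻ : ∀ {acc} u {v} → OuterFrom acc (u ++ v) → OuterFrom acc u × OuterFrom (acc ++ u) v
outer-++⁻ {acc} [] h = tt , subst (λ l → OuterFrom l _) (sym (++-identityʳ acc)) h
outer-++⁻ {acc} (c ∷ u) (o , h) with hu , hv ← outer-++⁻ u h =
  (o , hu) , subst (λ l → OuterFrom l _) (++-assoc acc [ c ] u) hv

-- A prefix L affects w only through its position relative to an entry r
-- already present: entries of w must not separate L from r.
outer-prefix⁺ : ∀ L {acc r} w → r ∈ acc → OuterFrom acc w →
                All (λ y → Outside y (L ++ [ r ])) w → OuterFrom (L ++ acc) w
outer-prefix⁺ L [] _ _ _ = tt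
outer-prefix⁺ L {acc} {r} (y ∷ w) r∈ (o , h) (o′ ∷ h′) =
  join o o′ ,
  subst (λ l → OuterFrom l w) (sym (++-assoc L acc [ y ])) (outer-prefix⁺ L w (∈-++⁺ˡ r∈) h h′)
  where
  atEnd : ∀ {P : Pred ℕ 0ℓ} → All P (L ++ [ r ]) → P r
  atEnd a = All.head (All.++⁻ʳ L a)
  join : Outside y acc → Outside y (L ++ [ r ]) → Outside y (L ++ acc)
  join (inj₁ a) (inj₁ b) = inj₁ (All.++⁺ (All.++⁻ˡ L b) a)
  join (inj₂ a) (inj₂ b) = inj₂ (All.++⁺ (All.++⁻ˡ L b) a)
  -- The entry `r` lies both in `acc` and in `L ++ [ r ]`, so `y` cannot be above one word and below
  -- the other.
  join (inj₁ a) (inj₂ b) = contradiction (All.lookup a r∈) (<⇒≯ (atEnd b))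
  join (inj₂ a) (inj₁ b) = contradiction (All.lookup a r∈) (<⇒≯ (atEnd b))

outer-prefix⁻ : ∀ L {acc r} w → r ∈ acc → OuterFrom (L ++ acc) w →
                OuterFrom acc w × All (λ y → Outside y (L ++ [ r ])) w
outer-prefix⁻ L [] _ _ = tt , []
outer-prefix⁻ L {acc} {r} (y ∷ w) r∈ (o , h)
  with h₁ , h₂ ← outer-prefix⁻ L w (∈-++⁺ˡ r∈) (subst (λ l → OuterFrom l w) (++-assoc L acc [ y ]) h)
  with o
... | inj₁ a = (inj₁ (All.++⁻ʳ L a) , h₁) ,
               inj₁ (All.++⁺ (All.++⁻ˡ L a) (All.lookup (All.++⁻ʳ L a) r∈ ∷ [])) ∷ h₂
... | inj₂ a = (inj₂ (All.++⁻ʳ L a) , h₁) ,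
               inj₂ (All.++⁺ (All.++⁻ˡ L a) (All.lookup (All.++⁻ʳ L a) r∈ ∷ [])) ∷ h₂

module _ {f : ℕ → ℕ} (mono : StrictMono f) where

  outer-map⁺ : ∀ {acc} w → OuterFrom acc w → OuterFrom (map f acc) (map f w)
  outer-map⁺ [] _ = tt
  outer-map⁺ {acc} (c ∷ w) (o , h) =
    outside o , subst (λ l → OuterFrom l (map f w)) (map-++ f acc [ c ]) (outer-map⁺ w h)
    where
    outside : Outside c acc → Outside (f c) (map f acc)
    outside (inj₁ a) = inj₁ (All.map⁺ (All.map mono a))
    outside (inj₂ a) = inj₂ (All.map⁺ (All.map mono a))

  outer-map⁻ : ∀ {acc} w → OuterFrom (map f acc) (map f w) → OuterFrom acc w
  outer-map⁻ [] _ = tt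
  outer-map⁻ {acc} (c ∷ w) (o , h) =
    outside o , outer-map⁻ w (subst (λ l → OuterFrom l (map f w)) (sym (map-++ f acc [ c ])) h)
    where
    outside : Outside (f c) (map f acc) → Outside c acc
    outside (inj₁ a) = inj₁ (All.map (strictMono-cancel-< mono) (All.map⁻ a))
    outside (inj₂ a) = inj₂ (All.map (strictMono-cancel-< mono) (All.map⁻ a))

-- Pattern avoidance as the outer condition

132-pattern 312-pattern : List ℕ
132-pattern = 1 ∷ 3 ∷ 2 ∷ []
312-pattern = 3 ∷ 1 ∷ 2 ∷ []

-- The recursion of `OuterFrom` moves entries from `w` to `acc`; counting the entries of `acc` as
-- preceding every position makes this set of values stable under that move.
Before : List ℕ → (w : List ℕ) → Fin (length w) → ℕ → Set
Before acc w k x = x ∈ acc ⊎ ∃[ i ] (i Fin.< k × lookup w i ≡ x)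

before-suc : ∀ {acc c w k x} → Before acc (c ∷ w) (suc k) x → Before (acc ++ [ c ]) w k x
before-suc       (inj₁ x∈)                     = inj₁ (∈-++⁺ˡ x∈)
before-suc {acc} (inj₂ (zero  , _ , refl))     = inj₁ (∈-++⁺ʳ acc (here refl))
before-suc       (inj₂ (suc i , s≤s i<k , eq)) = inj₂ (i , i<k , eq)

outer-lookup : ∀ {acc} w → OuterFrom acc w → ∀ k →
               (∀ {x} → Before acc w k x → x < lookup w k) ⊎
               (∀ {x} → Before acc w k x → lookup w k < x)
outer-lookup (c ∷ w) (inj₁ a , _) zero = inj₁ λ { (inj₁ x∈) → All.lookup a x∈ }
outer-lookup (c ∷ w) (inj₂ a , _) zero = inj₂ λ { (inj₁ x∈) → All.lookup a x∈ }
outer-lookup (c ∷ w) (_ , h) (suc k) with outer-lookup w h k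
... | inj₁ g = inj₁ (g ∘ before-suc)
... | inj₂ g = inj₂ (g ∘ before-suc)

-- Both 132 and 312 end in their middle value, so an occurrence of either one has a last entry with
-- a smaller and a larger entry before it, in one order or the other. Neither order matters here.
outer-no-middle : ∀ {w} → OuterFrom [] w → ∀ {i j k} → i Fin.< k → j Fin.< k →
                  lookup w i < lookup w k → ¬ (lookup w k < lookup w j)
outer-no-middle {w} h {k = k} i<k j<k x<z z<y with outer-lookup w h k
... | inj₁ g = <⇒≯ z<y (g (inj₂ (_ , j<k , refl)))
... | inj₂ g = <⇒≯ x<z (g (inj₂ (_ , i<k , refl)))

outer⇒avoids-132 : ∀ {w} → OuterFrom [] w → Avoids w 132-pattern
outer⇒avoids-132 h (ι , inc , iso) =
  outer-no-middle h (inc {zero} {suc (suc zero)} (s≤s z≤n))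
                  (inc {suc zero} {suc (suc zero)} (s≤s (s≤s z≤n)))
    (Equivalence.from (iso zero (suc (suc zero))) (s≤s (s≤s z≤n)))
    (Equivalence.from (iso (suc (suc zero)) (suc zero)) (s≤s (s≤s (s≤s z≤n))))

outer⇒avoids-312 : ∀ {w} → OuterFrom [] w → Avoids w 312-pattern
outer⇒avoids-312 h (ι , inc , iso) =
  outer-no-middle h (inc {suc zero} {suc (suc zero)} (s≤s (s≤s z≤n)))
                  (inc {zero} {suc (suc zero)} (s≤s z≤n))
    (Equivalence.from (iso (suc zero) (suc (suc zero))) (s≤s (s≤s z≤n)))
    (Equivalence.from (iso (suc (suc zero)) zero) (s≤s (s≤s (s≤s z≤n))))

-- Turns a sublist into the increasing index map that `Contains` asks for.
⊆-embedding : ∀ {xs w : List ℕ} → xs ⊆ w →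
              ∃[ ι ] ((∀ {a b} → a Fin.< b → ι a Fin.< ι b) × (∀ i → lookup w (ι i) ≡ lookup xs i))
⊆-embedding []       = (λ ()) , (λ { {()} }) , λ ()
⊆-embedding (y ∷ʳ τ) with ι , inc , eq ← ⊆-embedding τ = suc ∘ ι , s≤s ∘ inc , eq
⊆-embedding {x ∷ xs} {_ ∷ w} (refl ∷ τ) with ι , inc , eq ← ⊆-embedding τ = ι′ , inc′ , eq′
  where
  ι′ : Fin (suc (length xs)) → Fin (suc (length w))
  ι′ zero    = zero
  ι′ (suc i) = suc (ι i)
  inc′ : ∀ {a b} → a Fin.< b → ι′ a Fin.< ι′ b
  inc′ {zero}  {suc b} _        = s≤s z≤n
  inc′ {suc a} {suc b} (s≤s lt) = s≤s (inc lt)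
  eq′ : ∀ i → lookup (x ∷ w) (ι′ i) ≡ lookup (x ∷ xs) i
  eq′ zero    = refl
  eq′ (suc i) = eq i

-- `Contains` demands an equivalence of comparisons. The direction from `xs` back to the pattern
-- follows from `mono` by trichotomy, as the entries of the pattern are distinct.
⊆⇒contains : ∀ {a b c p q r w} → let xs = a ∷ b ∷ c ∷ []; π = p ∷ q ∷ r ∷ [] in
             xs ⊆ w → (∀ i j → lookup π i < lookup π j → lookup xs i < lookup xs j) →
             (∀ i j → lookup π i ≡ lookup π j → i ≡ j) → Contains w π
⊆⇒contains {a} {b} {c} {p} {q} {r} {w} τ mono inj with ι , inc , eq ← ⊆-embedding τ =
  ι , inc , λ i j →
    mk⇔ (back i j ∘ subst₂ _<_ (eq i) (eq j))
        (subst₂ _<_ (sym (eq i)) (sym (eq j)) ∘ mono i j)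
  where
  xs = a ∷ b ∷ c ∷ []
  π  = p ∷ q ∷ r ∷ []
  back : ∀ i j → lookup xs i < lookup xs j → lookup π i < lookup π j
  back i j lt with <-cmp (lookup π i) (lookup π j)
  ... | tri< l _ _ = l
  ... | tri≈ _ e _ = contradiction lt (<-irrefl (cong (lookup xs) (inj i j e)))
  ... | tri> _ _ g = contradiction lt (<⇒≯ (mono j i g))

contains-132 : ∀ {a b c w} → a ∷ b ∷ c ∷ [] ⊆ w → a < c → c < b → Contains w 132-pattern
contains-132 {a} {b} {c} τ a<c c<b = ⊆⇒contains τ mono
  (toWitness {a? = Fin.all? λ i → Fin.all? λ j →
                     (lookup 132-pattern i ≟ lookup 132-pattern j) →-dec (i Fin.≟ j)} tt)
  where
  mono : ∀ i j → lookup 132-pattern i < lookup 132-pattern j →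
         lookup (a ∷ b ∷ c ∷ []) i < lookup (a ∷ b ∷ c ∷ []) j
  mono zero             zero             (s≤s ())
  mono zero             (suc zero)       _ = <-trans a<c c<b
  mono zero             (suc (suc zero)) _ = a<c
  mono (suc zero)       zero             (s≤s ())
  mono (suc zero)       (suc zero)       (s≤s (s≤s (s≤s ())))
  mono (suc zero)       (suc (suc zero)) (s≤s (s≤s ()))
  mono (suc (suc zero)) zero             (s≤s ())
  mono (suc (suc zero)) (suc zero)       _ = c<b
  mono (suc (suc zero)) (suc (suc zero)) (s≤s (s≤s ()))

contains-312 : ∀ {a b c w} → a ∷ b ∷ c ∷ [] ⊆ w → b < c → c < a → Contains w 312-pattern
contains-312 {a} {b} {c} τ b<c c<a = ⊆⇒contains τ mono
  (toWitness {a? = Fin.all? λ i → Fin.all? λ j →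
                     (lookup 312-pattern i ≟ lookup 312-pattern j) →-dec (i Fin.≟ j)} tt)
  where
  mono : ∀ i j → lookup 312-pattern i < lookup 312-pattern j →
         lookup (a ∷ b ∷ c ∷ []) i < lookup (a ∷ b ∷ c ∷ []) j
  mono zero             zero             (s≤s (s≤s (s≤s ())))
  mono zero             (suc zero)       (s≤s ())
  mono zero             (suc (suc zero)) (s≤s (s≤s ()))
  mono (suc zero)       zero             _ = <-trans b<c c<a
  mono (suc zero)       (suc zero)       (s≤s ())
  mono (suc zero)       (suc (suc zero)) _ = b<c
  mono (suc (suc zero)) zero             _ = c<a
  mono (suc (suc zero)) (suc zero)       (s≤s ())
  mono (suc (suc zero)) (suc (suc zero)) (s≤s (s≤s ()))

pair-⊆ : ∀ {a b : ℕ} {u} → a ∈ u → b ∈ u → a ≢ b → a ∷ b ∷ [] ⊆ u ⊎ b ∷ a ∷ [] ⊆ u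
pair-⊆ (here refl) (here refl) a≢b = contradiction refl a≢b
pair-⊆ (here refl) (there b∈)  _   = inj₁ (refl ∷ Sublist.from∈ b∈)
pair-⊆ (there a∈)  (here refl) _   = inj₂ (refl ∷ Sublist.from∈ a∈)
pair-⊆ (there a∈)  (there b∈)  a≢b with pair-⊆ a∈ b∈ a≢b
... | inj₁ τ = inj₁ (_ ∷ʳ τ)
... | inj₂ τ = inj₂ (_ ∷ʳ τ)

module _ {w} (unique : Unique w) (av132 : Avoids w 132-pattern) (av312 : Avoids w 312-pattern) where

  -- If some `a` before `c` is larger than `c`, then no `b` before `c` can be smaller: the three
  -- would form 312 when `a` precedes `b`, and 132 when `b` precedes `a`.
  avoids⇒outside : ∀ u {c v} → w ≡ u ++ c ∷ v → Outside c u
  avoids⇒outside u {c} {v} refl with All.all? (_<? c) u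
  ... | yes all<c = inj₁ all<c
  ... | no ¬all<c with a , a∈ , a≮c ← find (All.¬All⇒Any¬ (_<? c) u ¬all<c) = inj₂ (All.tabulate above)
    where
    c∉u : ∀ {x} → x ∈ u → x ≢ c
    c∉u x∈ refl = proj₂ (proj₂ (unique-++⁻ u unique)) (x∈ , here refl)
    c<a : c < a
    c<a = ≤∧≢⇒< (≮⇒≥ a≮c) (c∉u a∈ ∘ sym)
    above : ∀ {b} → b ∈ u → c < b
    above {b} b∈ with <-cmp b c
    ... | tri≈ _ e _   = contradiction e (c∉u b∈)
    ... | tri> _ _ c<b = c<b
    ... | tri< b<c _ _ with pair-⊆ a∈ b∈ (>⇒≢ (<-trans b<c c<a))
    ...   | inj₁ τ = contradiction (contains-312 (Sublist.++⁺ τ (refl ∷ minimum v)) b<c c<a) av312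
    ...   | inj₂ τ = contradiction (contains-132 (Sublist.++⁺ τ (refl ∷ minimum v)) b<c c<a) av132

  avoids⇒outerFrom : ∀ acc v → w ≡ acc ++ v → OuterFrom acc v
  avoids⇒outerFrom acc []      eq = tt
  avoids⇒outerFrom acc (c ∷ v) eq =
    avoids⇒outside acc eq , avoids⇒outerFrom (acc ++ [ c ]) v (trans eq (sym (++-assoc acc [ c ] v)))

-- Permutations described by membership

InRange : ℕ → ℕ → Set
InRange n x = 1 ≤ x × x ≤ n

-- Interchangeable with `IsPermutation`, but convenient when a word is cut at its maximum or its
-- values are relabelled.
record Permutes (n : ℕ) (p : List ℕ) : Set where
  constructor permutes
  field
    unique : Unique p
    bound  : ∀ {x} → x ∈ p → InRange n x
    cover  : ∀ {x} → InRange n x → x ∈ p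

open Permutes

unique-resp-↭ : ∀ {p q : List ℕ} → p ↭ q → Unique p → Unique q
unique-resp-↭ τ = SetoidPerm.Unique-resp-↭ (setoid ℕ) (↭⇒↭ₛ τ)

permutes-resp-↭ : ∀ {n p q} → p ↭ q → Permutes n p → Permutes n q
permutes-resp-↭ τ (permutes u b c) =
  permutes (unique-resp-↭ τ u) (b ∘ ∈-resp-↭ (↭-sym τ)) (∈-resp-↭ τ ∘ c)

permutes-applyUpTo : ∀ n → Permutes n (applyUpTo suc n)
permutes-applyUpTo n = permutes
  (Unique.applyUpTo⁺₁ suc n (λ i<j _ → <⇒≢ (s≤s i<j)))
  (λ x∈ → bound′ (∈-applyUpTo⁻ suc x∈))
  (λ { {suc x} (_ , x<n) → ∈-applyUpTo⁺ suc x<n })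
  where
  bound′ : ∀ {x} → ∃[ i ] (i < n × x ≡ suc i) → InRange n x
  bound′ (_ , i<n , refl) = s≤s z≤n , i<n

isPermutation⇒permutes : ∀ {n p} → IsPermutation n p → Permutes n p
isPermutation⇒permutes {n} τ = permutes-resp-↭ (↭-sym τ) (permutes-applyUpTo n)

-- Two duplicate-free lists with the same elements agree as bags, hence up to rearrangement.
permutes⇒isPermutation : ∀ {n p} → Permutes n p → IsPermutation n p
permutes⇒isPermutation {n} P = ∼bag⇒↭ (unique∧set⇒bag (unique P) (unique Q)
  (mk⇔ (cover Q ∘ bound P) (cover P ∘ bound Q)))
  where Q = permutes-applyUpTo n

permutes-length : ∀ {n p} → Permutes n p → length p ≡ n
permutes-length {n} P = trans (↭-length (permutes⇒isPermutation P)) (length-applyUpTo suc n)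

permutes-s : ∀ {n p} → Permutes n p → Permutes n (s p)
permutes-s {p = p} P = permutes-resp-↭ (↭-sym (s-↭ p)) P

permutes-map⁻ : ∀ {f n p q} → StrictMono f → map f q ≡ p → Unique p →
                (∀ {x} → f x ∈ p → InRange n x) → (∀ {x} → InRange n x → f x ∈ p) → Permutes n q
permutes-map⁻ {f} mono refl u b c = permutes (Unique.map⁻ u) (b ∘ ∈-map⁺ f)
  λ r → let (_ , y∈ , eq) = ∈-map⁻ f (c r) in subst (_∈ _) (sym (strictMono-injective mono eq)) y∈

-- Words L ++ max ∷ R

-- The situation on the two sides of the maximum `suc m`: together `L` and `R` use each of the
-- values from 1 to `m` once.
record Split (m : ℕ) (L R : List ℕ) : Set where
  constructor split
  field
    uniqueˡ  : Unique L
    uniqueʳ  : Unique R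
    disjoint : Disjoint L R
    boundˡ   : ∀ {x} → x ∈ L → InRange m x
    boundʳ   : ∀ {x} → x ∈ R → InRange m x
    cover    : ∀ {x} → InRange m x → x ∈ L ⊎ x ∈ R

  allˡ : All (_< suc m) L
  allˡ = All.tabulate (s≤s ∘ proj₂ ∘ boundˡ)

  allʳ : All (_< suc m) R
  allʳ = All.tabulate (s≤s ∘ proj₂ ∘ boundʳ)

open Split

split⁺ : ∀ {m L R} → Split m L R → Permutes (suc m) (L ++ suc m ∷ R)
split⁺ {m} {L} {R} S = permutes
  (Unique.++⁺ (uniqueˡ S) (All.map >⇒≢ (allʳ S) ∷ uniqueʳ S)
    (λ { (x∈L , here refl)  → <-irrefl refl (All.lookup (allˡ S) x∈L)
       ; (x∈L , there x∈R) → disjoint S (x∈L , x∈R) }))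
  (λ x∈ → bound′ (∈-++⁻ L x∈))
  cover′
  where
  bound′ : ∀ {x} → x ∈ L ⊎ x ∈ suc m ∷ R → InRange (suc m) x
  bound′ (inj₁ x∈L)         = map₂ m≤n⇒m≤1+n (boundˡ S x∈L)
  bound′ (inj₂ (here refl)) = s≤s z≤n , ≤-refl
  bound′ (inj₂ (there x∈R)) = map₂ m≤n⇒m≤1+n (boundʳ S x∈R)
  cover′ : ∀ {x} → InRange (suc m) x → x ∈ L ++ suc m ∷ R
  cover′ {x} (1≤x , x≤1+m) with m≤n⇒m<n∨m≡n x≤1+m
  ... | inj₂ refl = ∈-insert L
  ... | inj₁ (s≤s x≤m) with cover S (1≤x , x≤m)
  ...   | inj₁ x∈L = ∈-++⁺ˡ x∈L
  ...   | inj₂ x∈R = ∈-++⁺ʳ L (there x∈R)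

split⁻ : ∀ {m p} → Permutes (suc m) p → ∃[ L ] ∃[ R ] (p ≡ L ++ suc m ∷ R × Split m L R)
split⁻ {m} P with L , R , refl ← ∈-∃++ (cover P (s≤s z≤n , ≤-refl))
  with uL , n∉R ∷ uR , L#R ← unique-++⁻ L (unique P) =
  L , R , refl , split uL uR (λ (x∈L , x∈R) → L#R (x∈L , there x∈R))
    (λ x∈L → smaller (bound P (∈-++⁺ˡ x∈L)) (λ { refl → L#R (x∈L , here refl) }))
    (λ x∈R → smaller (bound P (∈-++⁺ʳ L (there x∈R))) (λ { refl → All.lookup n∉R x∈R refl }))
    cover′
  where
  smaller : ∀ {x} → InRange (suc m) x → x ≢ suc m → InRange m x
  smaller (1≤x , x≤) x≢ = 1≤x , s≤s⁻¹ (≤∧≢⇒< x≤ x≢)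
  cover′ : ∀ {x} → InRange m x → x ∈ L ⊎ x ∈ R
  cover′ (1≤x , x≤m) with ∈-++⁻ L (cover P (1≤x , m≤n⇒m≤1+n x≤m))
  ... | inj₁ x∈L         = inj₁ x∈L
  ... | inj₂ (here refl) = contradiction x≤m 1+n≰n
  ... | inj₂ (there x∈R) = inj₂ x∈R

splitˡ⁺ : ∀ {m L} → Permutes m L → Split m L []
splitˡ⁺ P = split (unique P) [] (λ ()) (bound P) (λ ()) (inj₁ ∘ cover P)

splitʳ⁺ : ∀ {m R} → Permutes m R → Split m [] R
splitʳ⁺ P = split [] (unique P) (λ ()) (λ ()) (bound P) (inj₂ ∘ cover P)

splitˡ⁻ : ∀ {m L} → Split m L [] → Permutes m L
splitˡ⁻ S = permutes (uniqueˡ S) (boundˡ S) (λ r → [ id , (λ ()) ]′ (cover S r))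

splitʳ⁻ : ∀ {m R} → Split m [] R → Permutes m R
splitʳ⁻ S = permutes (uniqueʳ S) (boundʳ S) (λ r → [ (λ ()) , id ]′ (cover S r))

-- The middle entry exceeds all others, so its position is determined; at different positions each
-- of `m` and `n` would be smaller than the other. They are separate variables because the vertex
-- counts of two trees with equal words are not yet known to agree.
split-injective : ∀ {m n} L {R L′ R′} → All (_< m) L → All (_< m) R → All (_< n) L′ → All (_< n) R′ →
                  L ++ m ∷ R ≡ L′ ++ n ∷ R′ → L ≡ L′ × R ≡ R′
split-injective [] {L′ = []} _ _ _ _ refl = refl , refl
split-injective [] {L′ = _ ∷ L′} _ aR (m<n ∷ _) _ refl =
  contradiction (All.lookup aR (∈-insert L′)) (<⇒≯ m<n)
split-injective (_ ∷ L) {L′ = []} (n<m ∷ _) _ _ aR′ refl =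
  contradiction (All.lookup aR′ (∈-insert L)) (<⇒≯ n<m)
split-injective (x ∷ L) {L′ = y ∷ L′} (_ ∷ aL) aR (_ ∷ aL′) aR′ eq
  with refl , eq′ ← ∷-injective eq with refl , refl ← split-injective L aL aR aL′ aR′ eq′ = refl , refl

descents-max-∷ : ∀ {m} y R → y < m → descents (m ∷ y ∷ R) ≡ 1 + descents (y ∷ R)
descents-max-∷ {m} y R y<m with y <ᵇ m in eq
... | true  = refl
... | false = contradiction (subst T eq (<⇒<ᵇ y<m)) λ ()

-- The step from the last entry of `L` up to `m` is an ascent, so cutting there loses no descent.
descents-++-max : ∀ {m} L R → All (_< m) L → descents (L ++ m ∷ R) ≡ descents L + descents (m ∷ R)
descents-++-max [] R _ = refl
descents-++-max {m} (x ∷ []) R (x<m ∷ _) with m <ᵇ x in eq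
... | false = refl
... | true  = contradiction (<ᵇ⇒< m x (subst T (sym eq) tt)) (<⇒≯ x<m)
descents-++-max {m} (x ∷ y ∷ L) R (_ ∷ a) =
  trans (cong (_ +_) (descents-++-max (y ∷ L) R a)) (sym (+-assoc (if y <ᵇ x then 1 else 0) _ _))

-- For a permutation `p` this expresses that `s p` avoids 132 and 312.
Sortable : List ℕ → Set
Sortable p = OuterFrom [] (s p)

-- The last entry of the sorted word is its maximum, which is larger than everything before it and
-- so adds no condition.
sortable-split⁺ : ∀ {m L R} → Split m L R → OuterFrom [] (s L ++ s R) → Sortable (L ++ suc m ∷ R)
sortable-split⁺ {m} {L} {R} S h
  rewrite s-LmR L (suc m) R (allˡ S) (allʳ S) | sym (++-assoc (s L) (s R) [ suc m ]) =
  outer-++⁺ (s L ++ s R) h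
    (inj₁ (All.++⁺ (All-resp-↭ (↭-sym (s-↭ L)) (allˡ S)) (All-resp-↭ (↭-sym (s-↭ R)) (allʳ S))) , tt)

sortable-split⁻ : ∀ {m L R} → Split m L R → Sortable (L ++ suc m ∷ R) → OuterFrom [] (s L ++ s R)
sortable-split⁻ {m} {L} {R} S h
  rewrite s-LmR L (suc m) R (allˡ S) (allʳ S) | sym (++-assoc (s L) (s R) [ suc m ]) =
  proj₁ (outer-++⁻ (s L ++ s R) h)

-- Inserting a block of consecutive values

-- Fixes the values up to c and shifts the others by a, which frees c + 1, …, c + a.
gap : ℕ → ℕ → ℕ → ℕ
gap zero    a zero    = zero
gap zero    a (suc y) = a + suc y
gap (suc c) a zero    = zero
gap (suc c) a (suc y) = suc (gap c a y)

gap-≤ : ∀ {c} a {y} → y ≤ c → gap c a y ≡ y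
gap-≤ {zero}  a z≤n       = refl
gap-≤ {suc c} a z≤n       = refl
gap-≤ {suc c} a (s≤s y≤c) = cong suc (gap-≤ a y≤c)

gap-> : ∀ {c} a {y} → c < y → gap c a y ≡ a + y
gap-> {zero}  a {suc y} _         = refl
gap-> {suc c} a {suc y} (s≤s c<y) = trans (cong suc (gap-> a c<y)) (sym (+-suc a y))

gap-mono : ∀ c a → StrictMono (gap c a)
gap-mono c a {x} {y} x<y with x ≤? c | y ≤? c
... | yes x≤c | yes y≤c = subst₂ _<_ (sym (gap-≤ a x≤c)) (sym (gap-≤ a y≤c)) x<y
... | yes x≤c | no  y≰c = subst₂ _<_ (sym (gap-≤ a x≤c)) (sym (gap-> a (≰⇒> y≰c))) (m≤n⇒m≤o+n a x<y)
... | no  x≰c | yes y≤c = contradiction (≤-trans (<⇒≤ x<y) y≤c) x≰c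
... | no  x≰c | no  y≰c = subst₂ _<_ (sym (gap-> a (≰⇒> x≰c))) (sym (gap-> a (≰⇒> y≰c))) (+-monoʳ-< a x<y)

gap-∸ : ∀ c a {v} → c + a < v → c < v ∸ a × gap c a (v ∸ a) ≡ v
gap-∸ c a {v} c+a<v = c<y , trans (gap-> a c<y) (m+[n∸m]≡n (≤-trans (m≤n+m a c) (<⇒≤ c+a<v)))
  where
  c<y : c < v ∸ a
  c<y = m+n≤o⇒m≤o∸n (suc c) c+a<v

-- The shifted `L` fills exactly the values from `c + 1` to `c + a` that `gap c a` leaves free in
-- the image of `R`.
split-interleave : ∀ {a b c L R} → Permutes a L → Permutes b R → c ≤ b →
                   Split (a + b) (map (c +_) L) (map (gap c a) R)
split-interleave {a} {b} {c} {L} {R} P Q c≤b = split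
  (Unique.map⁺ (+-cancelˡ-≡ c _ _) (unique P))
  (Unique.map⁺ (strictMono-injective (gap-mono c a)) (unique Q))
  (λ (v∈ , v∈′) → disjoint′ (∈-map⁻ _ v∈) (∈-map⁻ _ v∈′))
  (boundˡ′ ∘ ∈-map⁻ _)
  (boundʳ′ ∘ ∈-map⁻ _)
  cover′
  where
  disjoint′ : ∀ {v} → ∃[ x ] (x ∈ L × v ≡ c + x) → ¬ (∃[ y ] (y ∈ R × v ≡ gap c a y))
  disjoint′ (x , x∈ , refl) (y , y∈ , eq) with y ≤? c
  ... | yes y≤c = <⇒≢ (≤-<-trans y≤c (m<m+n c (proj₁ (bound P x∈)))) (sym (trans eq (gap-≤ a y≤c)))
  ... | no  y≰c = <⇒≢ (≤-<-trans (+-monoʳ-≤ c (proj₂ (bound P x∈)))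
                        (subst (_< a + y) (+-comm a c) (+-monoʳ-< a (≰⇒> y≰c))))
                    (trans eq (gap-> a (≰⇒> y≰c)))
  boundˡ′ : ∀ {v} → ∃[ x ] (x ∈ L × v ≡ c + x) → InRange (a + b) v
  boundˡ′ (x , x∈ , refl) with 1≤x , x≤a ← bound P x∈ =
    m≤n⇒m≤o+n c 1≤x , subst (c + x ≤_) (+-comm b a) (+-mono-≤ c≤b x≤a)
  boundʳ′ : ∀ {v} → ∃[ y ] (y ∈ R × v ≡ gap c a y) → InRange (a + b) v
  boundʳ′ (y , y∈ , refl) with 1≤y , y≤b ← bound Q y∈ | y ≤? c
  ... | yes y≤c = subst (InRange (a + b)) (sym (gap-≤ a y≤c)) (1≤y , m≤n⇒m≤o+n a y≤b)
  ... | no  y≰c = subst (InRange (a + b)) (sym (gap-> a (≰⇒> y≰c))) (m≤n⇒m≤o+n a 1≤y , +-monoʳ-≤ a y≤b)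
  cover′ : ∀ {v} → InRange (a + b) v → v ∈ map (c +_) L ⊎ v ∈ map (gap c a) R
  cover′ {v} (1≤v , v≤) with v ≤? c | v ≤? c + a
  ... | yes v≤c | _ =
    inj₂ (subst (_∈ _) (gap-≤ a v≤c) (∈-map⁺ _ (cover Q (1≤v , ≤-trans v≤c c≤b))))
  ... | no  v≰c | yes v≤c+a =
    inj₁ (subst (_∈ _) (m+[n∸m]≡n (≰⇒≥ v≰c))
      (∈-map⁺ _ (cover P (m<n⇒0<n∸m (≰⇒> v≰c) , m≤n+o⇒m∸n≤o _ c v≤c+a))))
  ... | no  v≰c | no  v≰c+a =
    let (c<y , eq) = gap-∸ c a (≰⇒> v≰c+a) in
    inj₂ (subst (_∈ _) eq (∈-map⁺ _ (cover Q (≤-trans (s≤s z≤n) c<y , m≤n+o⇒m∸n≤o _ a v≤))))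

-- The words are indices, so that matching on the constructor replaces them by relabelled
-- permutations.
data Interleaving : ℕ → List ℕ → List ℕ → Set where
  interleaving : ∀ {a b L R} c → Permutes a L → Permutes b R → c ≤ b →
                 Interleaving (a + b) (map (c +_) L) (map (gap c a) R)

preimages : ∀ {f : ℕ → ℕ} p → (∀ {y} → y ∈ p → ∃[ x ] f x ≡ y) → ∃[ q ] map f q ≡ p
preimages []      h = [] , refl
preimages (y ∷ p) h with x , refl ← h (here refl) | q , refl ← preimages p (h ∘ there) = x ∷ q , refl

module _ {m x L R} (S : Split m (x ∷ L) R) (out : ∀ {y} → y ∈ R → Outside y (x ∷ L)) where

  -- No value of `R` lies between two values of the left part, so the left part consists of all
  -- values from its minimum `lo` to its maximum `hi`. Shifting this block down and closing the gap
  -- it leaves standardizes both parts.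
  split⇒interleaving : Interleaving m (x ∷ L) R
  split⇒interleaving = interleave (min x L) refl
    where
    lo = min x L
    hi = max x L

    lo∈ : lo ∈ x ∷ L
    lo∈ = argmin-all id {P = _∈ x ∷ L} (here refl) (All.tabulate there)
    hi∈ : hi ∈ x ∷ L
    hi∈ = argmax-all id {P = _∈ x ∷ L} (here refl) (All.tabulate there)
    lo≤ : All (lo ≤_) (x ∷ L)
    lo≤ = min≤⊤ x L ∷ min≤xs x L
    ≤hi : All (_≤ hi) (x ∷ L)
    ≤hi = ⊥≤max x L ∷ xs≤max x L

    hi≤m : hi ≤ m
    hi≤m = proj₂ (boundˡ S hi∈)

    between∈ : ∀ {v} → lo ≤ v → v ≤ hi → v ∈ x ∷ L
    between∈ lo≤v v≤hi with cover S (≤-trans (proj₁ (boundˡ S lo∈)) lo≤v , ≤-trans v≤hi hi≤m)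
    ... | inj₁ v∈ = v∈
    ... | inj₂ v∈ with out v∈
    ...   | inj₁ a = contradiction v≤hi (<⇒≱ (All.lookup a hi∈))
    ...   | inj₂ a = contradiction lo≤v (<⇒≱ (All.lookup a lo∈))

    -- Entries are positive, so `lo` has a predecessor `c`; the block then starts at `c + 1` and has
    -- size `hi ∸ c`.
    interleave : ∀ l → l ≡ lo → Interleaving m (x ∷ L) R
    interleave zero    eq = contradiction (proj₁ (boundˡ S lo∈)) (subst (1 ≰_) eq (λ ()))
    interleave (suc c) eq = subst₂ (λ k l → Interleaving k l R) (m+[n∸m]≡n a≤m) mapL′
      (subst (Interleaving (a + b) (map (c +_) L′)) mapR′ (interleaving c P Q c≤b))
      where
      a = hi ∸ c
      b = m ∸ a
      c<hi : c < hi
      c<hi = subst (_≤ hi) (sym eq) (All.lookup lo≤ hi∈)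
      c+a≡hi : c + a ≡ hi
      c+a≡hi = m+[n∸m]≡n (<⇒≤ c<hi)
      a≤m : a ≤ m
      a≤m = ≤-trans (m∸n≤m hi c) hi≤m
      a+b≡m : a + b ≡ m
      a+b≡m = m+[n∸m]≡n a≤m
      c≤b : c ≤ b
      c≤b = +-cancelˡ-≤ a c b (subst₂ _≤_ (trans (sym c+a≡hi) (+-comm c a)) (sym a+b≡m) hi≤m)

      block⁺ : ∀ {v} → c < v → v ≤ c + a → v ∈ x ∷ L
      block⁺ c<v v≤ = between∈ (subst (_≤ _) eq c<v) (subst (_ ≤_) c+a≡hi v≤)
      block⁻ : ∀ {v} → v ∈ x ∷ L → c < v × v ≤ c + a
      block⁻ v∈ = subst (_≤ _) (sym eq) (All.lookup lo≤ v∈) , subst (_ ≤_) (sym c+a≡hi) (All.lookup ≤hi v∈)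

      preimagesL = preimages {c +_} (x ∷ L) λ v∈ → _ , m+[n∸m]≡n (<⇒≤ (proj₁ (block⁻ v∈)))
      L′ = proj₁ preimagesL
      mapL′ = proj₂ preimagesL

      ungap : ∀ {v} → v ∈ R → ∃[ y ] gap c a y ≡ v
      ungap {v} v∈ with v ≤? c | v ≤? c + a
      ... | yes v≤c | _ = v , gap-≤ a v≤c
      ... | no  v≰c | yes v≤c+a = contradiction (block⁺ (≰⇒> v≰c) v≤c+a , v∈) (disjoint S)
      ... | no  v≰c | no  v≰c+a = v ∸ a , proj₂ (gap-∸ c a (≰⇒> v≰c+a))

      preimagesR = preimages R ungap
      R′ = proj₁ preimagesR
      mapR′ = proj₂ preimagesR

      P : Permutes a L′
      P = permutes-map⁻ (+-monoʳ-< c) mapL′ (uniqueˡ S)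
        (λ {y} y∈ → let (c<v , v≤) = block⁻ y∈ in
          +-cancelˡ-< c 0 y (subst (_< c + y) (sym (+-identityʳ c)) c<v) , +-cancelˡ-≤ c y a v≤)
        (λ (1≤y , y≤a) → block⁺ (m<m+n c 1≤y) (+-monoʳ-≤ c y≤a))

      boundR : ∀ {y} → gap c a y ∈ R → InRange b y
      boundR {y} y∈ with y ≤? c
      ... | yes y≤c = subst (1 ≤_) (gap-≤ a y≤c) (proj₁ (boundʳ S y∈)) , ≤-trans y≤c c≤b
      ... | no  y≰c = ≤-trans (s≤s z≤n) (≰⇒> y≰c) ,
        +-cancelˡ-≤ a y b (subst₂ _≤_ (gap-> a (≰⇒> y≰c)) (sym a+b≡m) (proj₂ (boundʳ S y∈)))

      coverR : ∀ {y} → InRange b y → gap c a y ∈ R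
      coverR {y} (1≤y , y≤b) with y ≤? c
      ... | yes y≤c rewrite gap-≤ a y≤c
        with cover S (1≤y , ≤-trans y≤b (m∸n≤m m a))
      ...   | inj₁ y∈ = contradiction y≤c (<⇒≱ (proj₁ (block⁻ y∈)))
      ...   | inj₂ y∈ = y∈
      coverR {y} (1≤y , y≤b) | no y≰c rewrite gap-> a (≰⇒> y≰c)
        with cover S (m≤n⇒m≤o+n a 1≤y , subst (a + y ≤_) a+b≡m (+-monoʳ-≤ a y≤b))
      ...   | inj₁ y∈ =
        contradiction (+-cancelˡ-≤ a y c (subst (a + y ≤_) (+-comm c a) (proj₂ (block⁻ y∈)))) y≰c
      ...   | inj₂ y∈ = y∈

      Q : Permutes b R′
      Q = permutes-map⁻ (gap-mono c a) mapR′ (uniqueʳ S) boundR coverR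

block-above : ∀ {a c l y} → Permutes a l → y ≤ c → All (gap c a y <_) (map (c +_) l)
block-above {a} {c} P y≤c = All.map⁺ (All.tabulate λ x∈ →
  subst (_< _) (sym (gap-≤ a y≤c)) (≤-<-trans y≤c (m<m+n c (proj₁ (bound P x∈)))))

block-below : ∀ {a c l y} → Permutes a l → c < y → All (_< gap c a y) (map (c +_) l)
block-below {a} {c} {y = y} P c<y = All.map⁺ (All.tabulate λ {x} x∈ →
  subst (c + x <_) (trans (+-comm y a) (sym (gap-> a c<y))) (+-mono-<-≤ c<y (proj₂ (bound P x∈))))

module _ {a b c r : ℕ} {l w : List ℕ} (P : Permutes a l) (Q : Permutes b (r ∷ w)) where

  private
    g : ℕ → ℕ
    g = gap c a

    r∉w : ∀ {y} → y ∈ w → y ≢ r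
    r∉w y∈ refl with r∉ ∷ _ ← unique Q = All.lookup r∉ y∈ refl

  -- The condition on c says that the inserted block is adjacent to the image of r.
  outer-interleave⁺ : c ≤ r → r ≤ suc c → OuterFrom [] l → OuterFrom [] (r ∷ w) →
                      OuterFrom [] (map (c +_) l ++ map g (r ∷ w))
  outer-interleave⁺ c≤r r≤1+c hl (_ , hw) =
    outer-++⁺ (map (c +_) l) (outer-map⁺ (+-monoʳ-< c) l hl)
      (first-outside ,
       outer-prefix⁺ (map (c +_) l) (map g w) (here refl) (outer-map⁺ (gap-mono c a) w hw)
         (All.map⁺ (All.tabulate rest-outside)))
    where
    first-outside : Outside (g r) (map (c +_) l)
    first-outside with r ≤? c
    ... | yes r≤c = inj₂ (block-above P r≤c)
    ... | no  r≰c = inj₁ (block-below P (≰⇒> r≰c))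
    -- By adjacency, entries of `w` below `r` are at most `c` and those above `r` exceed `c`; hence
    -- the block and the image of `r` lie on the same side of each.
    rest-outside : ∀ {y} → y ∈ w → Outside (g y) (map (c +_) l ++ [ g r ])
    rest-outside {y} y∈ with <-cmp y r
    ... | tri< y<r _ _ = inj₂ (All.++⁺ (block-above P (s≤s⁻¹ (≤-trans y<r r≤1+c))) (gap-mono c a y<r ∷ []))
    ... | tri≈ _ y≡r _ = contradiction y≡r (r∉w y∈)
    ... | tri> _ _ r<y = inj₁ (All.++⁺ (block-below P (≤-<-trans c≤r r<y)) (gap-mono c a r<y ∷ []))

  -- A block not adjacent to the image of `r` would be separated from it by an entry of `w`: by the
  -- image of `c` if `r < c`, and by that of `suc c` if `suc c < r`. The bound `1 ≤ a` provides an
  -- entry of the block to compare with.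
  outer-interleave⁻ : 1 ≤ a → c ≤ b → OuterFrom [] (map (c +_) l ++ map g (r ∷ w)) →
                      (OuterFrom [] l × OuterFrom [] (r ∷ w)) × c ≤ r × r ≤ suc c
  outer-interleave⁻ 1≤a c≤b h
    with hl , _ , hr ← outer-++⁻ (map (c +_) l) h
    with hw , out ← outer-prefix⁻ (map (c +_) l) (map g w) (here refl) hr =
    (outer-map⁻ (+-monoʳ-< c) l hl , inj₁ [] , outer-map⁻ (gap-mono c a) w hw) , c≤r , r≤1+c
    where
    1∈block : c + 1 ∈ map (c +_) l
    1∈block = ∈-map⁺ (c +_) (cover P (≤-refl , 1≤a))

    ∈w : ∀ {y} → InRange b y → y ≢ r → y ∈ w
    ∈w range y≢r with cover Q range
    ... | here y≡r = contradiction y≡r y≢r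
    ... | there y∈ = y∈

    outside : ∀ {y} → y ∈ w → Outside (g y) (map (c +_) l ++ [ g r ])
    outside = All.lookup (All.map⁻ out)

    c≤r : c ≤ r
    c≤r with c ≤? r
    ... | yes p = p
    ... | no c≰r with outside (∈w (≤-trans (s≤s z≤n) (≰⇒> c≰r) , c≤b) (>⇒≢ (≰⇒> c≰r)))
    ...   | inj₁ all< = contradiction (All.lookup (block-above P ≤-refl) 1∈block)
                          (<⇒≯ (All.lookup all< (∈-++⁺ˡ 1∈block)))
    ...   | inj₂ all> = contradiction (gap-mono c a (≰⇒> c≰r))
                          (<⇒≯ (All.head (All.++⁻ʳ (map (c +_) l) all>)))

    r≤1+c : r ≤ suc c
    r≤1+c with r ≤? suc c
    ... | yes p = p
    ... | no r≰
      with outside (∈w (s≤s z≤n , ≤-trans (<⇒≤ (≰⇒> r≰)) (proj₂ (bound Q (here refl)))) (<⇒≢ (≰⇒> r≰)))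
    ...   | inj₁ all< = contradiction (gap-mono c a (≰⇒> r≰))
                          (<⇒≯ (All.head (All.++⁻ʳ (map (c +_) l) all<)))
    ...   | inj₂ all> = contradiction (All.lookup (block-below P ≤-refl) 1∈block)
                          (<⇒≯ (All.lookup all> (∈-++⁺ˡ 1∈block)))

-- The word of a 0-1-tree

-- The default 0 is not reached on the sorted word of a tree, which is nonempty.
first : List ℕ → ℕ
first []      = 0
first (x ∷ _) = x

-- The bijection from trees to words: the root becomes the maximum, and `leftWord` and `rightWord`
-- are the parts around it, with their values already relabelled.
word leftWord rightWord : ZeroOneTree → List ℕ
offset : Fin 2 → ZeroOneTree → ℕ

word t = leftWord t ++ vertices t ∷ rightWord t

leftWord leaf          = []
leftWord (onlyLeft l)  = word l
leftWord (onlyRight r) = []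
leftWord (both i l r)  = map (offset i r +_) (word l)

rightWord leaf          = []
rightWord (onlyLeft l)  = []
rightWord (onlyRight r) = word r
rightWord (both i l r)  = map (gap (offset i r) (vertices l)) (word r)

-- Label 0 puts the values of the left part immediately below the image of the
-- first entry of s (word r), label 1 immediately above it.
offset i r = Fin.toℕ i + pred (first (s (word r)))

subvertices : ZeroOneTree → ℕ
subvertices t = pred (vertices t)

vertices-suc : ∀ t → vertices t ≡ suc (subvertices t)
vertices-suc leaf          = refl
vertices-suc (onlyLeft _)  = refl
vertices-suc (onlyRight _) = refl
vertices-suc (both _ _ _)  = refl

vertices-positive : ∀ t → 1 ≤ vertices t
vertices-positive t = subst (1 ≤_) (sym (vertices-suc t)) (s≤s z≤n)

first∈ : ∀ {n p} → 1 ≤ n → Permutes n p → first (s p) ∈ s p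
first∈ {p = p} 1≤n P with s p | cover (permutes-s P) (≤-refl , 1≤n)
... | _ ∷ _ | _ = here refl

first-range : ∀ {n p} → 1 ≤ n → Permutes n p → InRange n (first (s p))
first-range 1≤n P = bound (permutes-s P) (first∈ 1≤n P)

-- Since `s` commutes with both relabellings, this reduces to interleaving the words `s L` and
-- `s R`.
sortable-interleave⁺ : ∀ {a b c L R} → Permutes a L → Permutes b R →
                       let r = first (s R) in c ≤ r → r ≤ suc c → Sortable L → Sortable R →
                       OuterFrom [] (s (map (c +_) L) ++ s (map (gap c a) R))
sortable-interleave⁺ {a} {b} {c} {L} {R} P Q c≤r r≤1+c hL hR
  rewrite s-map (+-monoʳ-< c) L | s-map (gap-mono c a) R
  with s R | permutes-s Q | hR
... | []    | _  | _   = subst (OuterFrom []) (sym (++-identityʳ _)) (outer-map⁺ (+-monoʳ-< c) (s L) hL)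
... | r ∷ w | Q′ | hR′ = outer-interleave⁺ (permutes-s P) Q′ c≤r r≤1+c hL hR′

sortable-interleave⁻ : ∀ {a b c L R} → Permutes a L → Permutes b R → 1 ≤ a → 1 ≤ b → c ≤ b →
                       OuterFrom [] (s (map (c +_) L) ++ s (map (gap c a) R)) →
                       let r = first (s R) in (Sortable L × Sortable R) × c ≤ r × r ≤ suc c
sortable-interleave⁻ {a} {b} {c} {L} {R} P Q 1≤a 1≤b c≤b h
  rewrite s-map (+-monoʳ-< c) L | s-map (gap-mono c a) R
  with s R | permutes-s Q
... | []    | Q′ with () ← cover Q′ (≤-refl , 1≤b)
... | r ∷ w | Q′ = outer-interleave⁻ (permutes-s P) Q′ 1≤a c≤b h

offset≤first : ∀ (i : Fin 2) {r} → 1 ≤ r → Fin.toℕ i + pred r ≤ r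
offset≤first i {suc r} _ = +-monoˡ-≤ r (toℕ≤pred[n] i)

first≤1+offset : ∀ (i : Fin 2) r → r ≤ suc (Fin.toℕ i + pred r)
first≤1+offset i zero    = z≤n
first≤1+offset i (suc r) = s≤s (m≤n+m r (Fin.toℕ i))

-- Proved together with `word-permutes`: as the word of `r` is a permutation, the first entry of its
-- sorted form lies between 1 and `vertices r`, which keeps `offset i r` within the bound that
-- `split-interleave` needs.
word-split    : ∀ t → Split (subvertices t) (leftWord t) (rightWord t)
word-permutes : ∀ t → Permutes (vertices t) (word t)

word-permutes t =
  subst (λ n → Permutes n (leftWord t ++ n ∷ rightWord t)) (sym (vertices-suc t)) (split⁺ (word-split t))

word-split leaf          = split [] [] (λ ()) (λ ()) (λ ()) (λ { (s≤s _ , ()) })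
word-split (onlyLeft l)  = splitˡ⁺ (word-permutes l)
word-split (onlyRight r) = splitʳ⁺ (word-permutes r)
word-split (both i l r)  = split-interleave (word-permutes l) (word-permutes r) (≤-trans (offset≤first i 1≤f) f≤)
  where
  1≤f = proj₁ (first-range (vertices-positive r) (word-permutes r))
  f≤  = proj₂ (first-range (vertices-positive r) (word-permutes r))

word-sortable : ∀ t → Sortable (word t)
word-sortable t = subst (λ n → Sortable (leftWord t ++ n ∷ rightWord t)) (sym (vertices-suc t))
  (sortable-split⁺ (word-split t) (parts t))
  where
  parts : ∀ t → OuterFrom [] (s (leftWord t) ++ s (rightWord t))
  parts leaf          = tt
  parts (onlyLeft l)  = subst (OuterFrom []) (sym (++-identityʳ _)) (word-sortable l)
  parts (onlyRight r) = word-sortable r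
  parts (both i l r)  = sortable-interleave⁺ (word-permutes l) (word-permutes r)
    (offset≤first i (proj₁ (first-range (vertices-positive r) (word-permutes r))))
    (first≤1+offset i _) (word-sortable l) (word-sortable r)

-- The word of a subtree is nonempty, so a maximum in front of it creates one descent. This descent
-- corresponds to the right edge at the root.
descents-∷-word : ∀ {m f} t → StrictMono f → All (_< m) (map f (word t)) →
                  descents (m ∷ map f (word t)) ≡ 1 + descents (word t)
descents-∷-word t mono a
  with word t | descents-map mono (word t) | cover (word-permutes t) (≤-refl , vertices-positive t)
... | y ∷ p | eq | _ = trans (descents-max-∷ _ (map _ p) (All.head a)) (cong suc eq)

descents-word : ∀ t → descents (word t) ≡ rightEdges t
descents-word t =
  trans (descents-++-max (leftWord t) (rightWord t)
          (subst (λ n → All (_< n) (leftWord t)) (sym (vertices-suc t)) (allˡ (word-split t))))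
        (parts t)
  where
  parts : ∀ t → descents (leftWord t) + descents (vertices t ∷ rightWord t) ≡ rightEdges t
  parts leaf          = refl
  parts (onlyLeft l)  = trans (+-identityʳ _) (descents-word l)
  -- The word of an only child keeps its values, so it is treated as relabelled by the identity.
  parts (onlyRight r) = trans (cong (descents ∘ (vertices (onlyRight r) ∷_)) (sym (map-id (word r))))
    (trans (descents-∷-word r id (subst (All _) (sym (map-id (word r))) (allʳ (word-split (onlyRight r)))))
      (cong suc (descents-word r)))
  parts (both i l r)  = trans
    (cong₂ _+_ (trans (descents-map (+-monoʳ-< (offset i r)) (word l)) (descents-word l))
      (trans (descents-∷-word r (gap-mono (offset i r) (vertices l)) (allʳ (word-split (both i l r))))
        (cong suc (descents-word r))))
    (+-suc _ _)

-- Injectivity of the word map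

word-length : ∀ t → length (word t) ≡ vertices t
word-length t = permutes-length (word-permutes t)

word≢[] : ∀ t → word t ≢ []
word≢[] t eq with () ← subst (1 ≤_) (trans (sym (word-length t)) (cong length eq)) (vertices-positive t)

map-word≢[] : ∀ {f : ℕ → ℕ} t → map f (word t) ≢ []
map-word≢[] {f} t eq = word≢[] t (map-≡[] (word t) eq)
  where
  map-≡[] : ∀ p → map f p ≡ [] → p ≡ []
  map-≡[] [] _ = refl

-- Both permutations have least entry 1, so the least entry of the common image is `c + 1` as well
-- as `d + 1`.
translate-injective : ∀ {n c d p q} → 1 ≤ n → Permutes n p → Permutes n q →
                      map (c +_) p ≡ map (d +_) q → c ≡ d
translate-injective 1≤n P Q eq = ≤-antisym (least Q P (sym eq)) (least P Q eq)
  where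
  least : ∀ {c d p q} → Permutes _ p → Permutes _ q → map (c +_) p ≡ map (d +_) q → d ≤ c
  least {c} {d} P Q eq
    with z , z∈ , e ← ∈-map⁻ (d +_) (subst (c + 1 ∈_) eq (∈-map⁺ (c +_) (cover P (≤-refl , 1≤n)))) =
    +-cancelʳ-≤ 1 d c (subst (d + 1 ≤_) (sym e) (+-monoʳ-≤ d (proj₁ (bound Q z∈))))

-- Cutting at the maximum recovers both parts, and which of them are empty gives the kind of the
-- root. If neither is, the length of the left part gives `vertices l` and its least value gives the
-- offset; undoing the relabellings yields `l` and `r` by recursion, and then the offset determines
-- the label.
word-injective : ∀ {t u} → word t ≡ word u → t ≡ u
word-injective {t} {u} eq =
  uncurry (parts t u) (split-injective (leftWord t)
                        (below t (allˡ (word-split t))) (below t (allʳ (word-split t)))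
                        (below u (allˡ (word-split u))) (below u (allʳ (word-split u))) eq)
  where
  below : ∀ t {p} → All (_< suc (subvertices t)) p → All (_< vertices t) p
  below t = subst (λ n → All (_< n) _) (sym (vertices-suc t))

  parts : ∀ t u → leftWord t ≡ leftWord u → rightWord t ≡ rightWord u → t ≡ u
  parts leaf          leaf          _  _  = refl
  parts leaf          (onlyLeft l)  eq _  = contradiction (sym eq) (word≢[] l)
  parts leaf          (onlyRight r) _  eq = contradiction (sym eq) (word≢[] r)
  parts leaf          (both i l r)  _  eq = contradiction (sym eq) (map-word≢[] r)
  parts (onlyLeft l)  leaf          eq _  = contradiction eq (word≢[] l)
  parts (onlyLeft l)  (onlyLeft l′) eq _  = cong onlyLeft (word-injective eq)
  parts (onlyLeft l)  (onlyRight r) eq _  = contradiction eq (word≢[] l)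
  parts (onlyLeft l)  (both i _ r)  _  eq = contradiction (sym eq) (map-word≢[] r)
  parts (onlyRight r) leaf          _  eq = contradiction eq (word≢[] r)
  parts (onlyRight r) (onlyLeft l)  _  eq = contradiction eq (word≢[] r)
  parts (onlyRight r) (onlyRight _) _  eq = cong onlyRight (word-injective eq)
  parts (onlyRight r) (both i l _)  eq _  = contradiction (sym eq) (map-word≢[] l)
  parts (both i l r)  leaf          eq _  = contradiction eq (map-word≢[] l)
  parts (both i l r)  (onlyLeft _)  _  eq = contradiction eq (map-word≢[] r)
  parts (both i l r)  (onlyRight _) eq _  = contradiction eq (map-word≢[] l)
  parts (both i l r)  (both j l′ r′) eqL eqR = both-≡ (vertices-≡ lengths) eqL eqR
    where
    lengths : length (word l) ≡ length (word l′)
    lengths = trans (sym (length-map _ (word l))) (trans (cong length eqL) (length-map _ (word l′)))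
    vertices-≡ : length (word l) ≡ length (word l′) → vertices l ≡ vertices l′
    vertices-≡ e = trans (sym (word-length l)) (trans e (word-length l′))
    both-≡ : vertices l ≡ vertices l′ → leftWord (both i l r) ≡ leftWord (both j l′ r′) →
             rightWord (both i l r) ≡ rightWord (both j l′ r′) → both i l r ≡ both j l′ r′
    both-≡ v≡ eqL eqR
      with o≡ ← translate-injective (vertices-positive l) (word-permutes l)
                  (subst (λ n → Permutes n (word l′)) (sym v≡) (word-permutes l′)) eqL
      with refl ← word-injective {l} {l′} (map-injective (+-cancelˡ-≡ (offset i r) _ _)
                    (trans eqL (cong (λ o → map (o +_) (word l′)) (sym o≡))))
      with refl ← word-injective {r} {r′} (map-injective (strictMono-injective (gap-mono (offset i r) (vertices l)))
                    (trans eqR (cong (λ o → map (gap o (vertices l)) (word r′)) (sym o≡)))) =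
      cong (λ k → both k l r) (toℕ-injective (+-cancelʳ-≡ (pred (first (s (word r)))) (Fin.toℕ i) (Fin.toℕ j) o≡))

-- Surjectivity of the word map

outerFrom⇒outside : ∀ {acc w y} → OuterFrom acc w → y ∈ w → Outside y acc
outerFrom⇒outside (o , _) (here refl) = o
outerFrom⇒outside {acc} (_ , h) (there y∈) with outerFrom⇒outside h y∈
... | inj₁ a = inj₁ (All.++⁻ˡ acc a)
... | inj₂ a = inj₂ (All.++⁻ˡ acc a)

-- In `s L ++ s R` all of `s L` precedes each entry of `s R`, and sorting only rearranges the
-- entries of `L` and of `R`.
sorted-outside : ∀ {L R y} → OuterFrom [] (s L ++ s R) → y ∈ R → Outside y L
sorted-outside {L} {R} h y∈
  with outerFrom⇒outside (proj₂ (outer-++⁻ (s L) h)) (∈-resp-↭ (↭-sym (s-↭ R)) y∈)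
... | inj₁ a = inj₁ (All-resp-↭ (s-↭ L) a)
... | inj₂ a = inj₂ (All-resp-↭ (s-↭ L) a)

-- Adjacency leaves only the offsets `pred r` and `r`, which are those of the labels 0 and 1.
offset-surjective : ∀ {c r} → 1 ≤ r → c ≤ r → r ≤ suc c → ∃[ i ] Fin.toℕ {2} i + pred r ≡ c
offset-surjective {r = suc r} _ c≤r r≤1+c with m≤n⇒m<n∨m≡n c≤r
... | inj₁ c<r = zero , ≤-antisym (s≤s⁻¹ r≤1+c) (s≤s⁻¹ c<r)
... | inj₂ c≡r = suc zero , sym c≡r

IsWord : List ℕ → Set
IsWord p = ∃[ t ] word t ≡ p

nonempty : ∀ {n x p} → Permutes n p → x ∈ p → 1 ≤ n
nonempty P x∈ = uncurry ≤-trans (bound P x∈)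

word-vertices : ∀ {n} t → Permutes n (word t) → vertices t ≡ n
word-vertices t P = trans (sym (word-length t)) (permutes-length P)

split-[] : ∀ {m} → Split m [] [] → m ≡ 0
split-[] {zero}  S = refl
split-[] {suc m} S = contradiction (cover S (≤-refl , s≤s z≤n)) [ (λ ()) , (λ ()) ]′

module _ {m} (ih : ∀ {n p} → 1 ≤ n → n ≤ m → Permutes n p → Sortable p → IsWord p) where

  -- The entries `x` and `y` witness that both parts are nonempty. The induction hypothesis gives
  -- the subtrees, and adjacency of the block to the first entry of the sorted right part gives the
  -- label.
  interleaving⇒isWord : ∀ {L R x y} → x ∈ L → y ∈ R → Interleaving m L R →
                        OuterFrom [] (s L ++ s R) → IsWord (L ++ suc m ∷ R)
  interleaving⇒isWord x∈ y∈ (interleaving {a} {b} c P Q c≤b) h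
    with _ , x∈′ , _ ← ∈-map⁻ _ x∈ | _ , y∈′ , _ ← ∈-map⁻ _ y∈
    with 1≤a ← nonempty P x∈′ | 1≤b ← nonempty Q y∈′
    with (hL , hR) , c≤r , r≤1+c ← sortable-interleave⁻ P Q 1≤a 1≤b c≤b h
    with l , refl ← ih 1≤a (m≤m+n a b) P hL | r , refl ← ih 1≤b (m≤n+m b a) Q hR
    -- Once `a`, `b` and `c` are replaced by the vertex counts and the offset, the given word is the
    -- word of the assembled tree by definition.
    with refl ← word-vertices l P | refl ← word-vertices r Q
    with i , refl ← offset-surjective (proj₁ (first-range 1≤b Q)) c≤r r≤1+c =
    both i l r , refl

  -- Which of the two parts are empty decides whether the root is a leaf, has an only child, or has
  -- two children.
  split⇒isWord : ∀ L R → Split m L R → OuterFrom [] (s L ++ s R) → IsWord (L ++ suc m ∷ R)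
  split⇒isWord [] [] S h = leaf , cong (λ n → suc n ∷ []) (sym (split-[] S))
  split⇒isWord [] R@(_ ∷ _) S h
    with r , eq ← ih (uncurry ≤-trans (boundʳ S (here refl))) ≤-refl (splitʳ⁻ S) h =
    onlyRight r , cong₂ (λ n q → suc n ∷ q) (word-vertices r (subst (Permutes m) (sym eq) (splitʳ⁻ S))) eq
  split⇒isWord L@(_ ∷ _) [] S h
    with l , eq ← ih (uncurry ≤-trans (boundˡ S (here refl))) ≤-refl (splitˡ⁻ S)
                  (subst (OuterFrom []) (++-identityʳ (s L)) h) =
    onlyLeft l , cong₂ (λ n q → q ++ suc n ∷ []) (word-vertices l (subst (Permutes m) (sym eq) (splitˡ⁻ S))) eq
  split⇒isWord L@(_ ∷ _) R@(_ ∷ _) S h =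
    interleaving⇒isWord (here refl) (here refl) (split⇒interleaving S (sorted-outside h)) h

-- d bounds the length of p and only serves the recursion.
word-surjective : ∀ d {n p} → 1 ≤ n → n ≤ d → Permutes n p → Sortable p → IsWord p
word-surjective (suc d) {suc m} _ (s≤s m≤d) P h with L , R , refl , S ← split⁻ P =
  split⇒isWord (λ 1≤n n≤m → word-surjective d 1≤n (≤-trans n≤m m≤d)) L R S (sortable-split⁻ S h)

-- Counting along the bijection

hasCardinality-map : ∀ {A B : Set} {P : Pred A 0ℓ} {Q : Pred B 0ℓ} {N} (f : A → B) →
                     (∀ {x y} → f x ≡ f y → x ≡ y) → (∀ x → P x → Q (f x)) →
                     (∀ {y} → Q y → ∃[ x ] (P x × f x ≡ y)) → HasCardinality P N → HasCardinality Q N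
hasCardinality-map {P = P} {Q} f inj to from (xs , u , P⇔ , len) =
  map f xs , Unique.map⁺ inj u , (λ y → mk⇔ (sound ∘ ∈-map⁻ f) (complete ∘ from)) , trans (length-map f xs) len
  where
  sound : ∀ {y} → ∃[ x ] (x ∈ xs × y ≡ f x) → Q y
  sound (x , x∈ , refl) = to x (Equivalence.to (P⇔ x) x∈)
  complete : ∀ {y} → ∃[ x ] (P x × f x ≡ y) → y ∈ map f xs
  complete (x , px , refl) = ∈-map⁺ f (Equivalence.from (P⇔ x) px)

proposition2p2 : (n k : ℕ) → 1 ≤ n → 1 ≤ k →
    HasCardinality
    (λ p → s⁻¹Av n (1 ∷ 3 ∷ 2 ∷ []) (3 ∷ 1 ∷ 2 ∷ []) p × suc (descents p) ≡ k)
    (BoNa n k)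
proposition2p2 n k 1≤n _ =
  hasCardinality-map word (λ {t} {u} → word-injective {t} {u}) sound complete (BoNa-counts n k)
  where
  sound : ∀ t → BoNaTree n k t →
          s⁻¹Av n 132-pattern 312-pattern (word t) × suc (descents (word t)) ≡ k
  sound t (refl , refl) =
    (permutes⇒isPermutation P , permutes⇒isPermutation (permutes-s P) ,
     outer⇒avoids-132 (word-sortable t) , outer⇒avoids-312 (word-sortable t)) ,
    cong suc (descents-word t)
    where P = word-permutes t
  complete : ∀ {p} → s⁻¹Av n 132-pattern 312-pattern p × suc (descents p) ≡ k →
             ∃[ t ] (BoNaTree n k t × word t ≡ p)
  complete ((isPerm , _ , av132 , av312) , refl)
    with P ← isPermutation⇒permutes isPerm
    -- Reading `s p` from the empty prefix turns avoidance of the two patterns into sortability of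
    -- `p`; the length `n` itself serves as the recursion bound.
    with t , refl ← word-surjective n 1≤n ≤-refl P
                      (avoids⇒outerFrom (unique (permutes-s P)) av132 av312 [] _ refl) =
    t , (word-vertices t P , cong suc (sym (descents-word t))) , refl
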